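{- If a regular cardinal $\kappa>2^{\aleph_1}$ carries a uniform indecomposable ultrafilter, then every $\kappa$-Aronszajn tree admits an $\omega$-ascent path.
   Context: An ultrafilter $U$ over $\kappa$ is uniform if all its members have size $\kappa$; it is $\mu$-indecomposable if for every $f:\kappa\to\mu$ there is $H\subseteq\mu$ with $|H|<\mu$ and $f^{ -1}[H]\in U$; it is indecomposable if it is $\mu$-indecomposable for all cardinals $\mu\in[\aleph_1,\kappa)$. For a tree $(T,<_T)$ of height $\kappa$ with levels $T_\alpha$, an $\omega$-ascent path is a sequence $\langle f_\alpha\mid\alpha<\kappa\rangle$ with $f_\alpha:\omega\to T_\alpha$ such that for all $\alpha<\beta<\kappa$, the set $\{i<\omega\mid f_\alpha(i)<_T f_\beta(i)\}$ contains a tail of $\omega$ (i.e., is cofinite). -}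

module Defs where

-- Conventions.
--
-- Sets are types in Set.  A cardinality is a type up to bijection, and
-- cardinalities are compared by injections.  Only κ, whose elements also
-- index the levels of a tree, is given as an initial ordinal: a type K with a
-- well-order _<_, the elements of K being the ordinals below κ.
--
-- The ambient logic is classical with choice.  ExcludedMiddle for all types
-- (not only propositions) picks an element of every non-empty type, so it
-- yields choice functions for families of types; together with function
-- extensionality this includes choice functions on the subsets A → Bool of A.
--
-- The size of a subset P is that of the refinement type [ x ∈ A ∣ P x ], whose
-- membership proofs are irrelevant, so each x is counted at most once even
-- if P x has several proofs.

open import Data.Bool.Base using (Bool)
open import Data.Nat.Base using (ℕ; _≤_)
open import Data.Product.Base using (_×_; ∃; ∃-syntax)
open import Data.Refinement.Base using (Refinement; Refinement-syntax; value)
open import Data.Sum.Base using (_⊎_)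
open import Function.Base using (_on_)
open import Function.Bundles using (_↣_; _↔_)
open import Induction.WellFounded using (WellFounded)
open import Level using (0ℓ)
open import Relation.Binary.Core using (Rel)
open import Relation.Binary.Morphism.Structures using (IsOrderIsomorphism)
open import Relation.Binary.PropositionalEquality.Core using (_≡_)
open import Relation.Binary.Structures using (IsStrictPartialOrder; IsStrictTotalOrder)
open import Relation.Nullary.Negation.Core using (¬_)
import Relation.Unary as Unary
open Unary using (Pred; _∈_; _∉_; _⊆_; _∩_; ∁; _⊢_)

infix 4 _≺_

_≺_ : Set → Set → Set
A ≺ B = (A ↣ B) × ¬ (B ↣ A)

-- ℵ₁ is the least uncountable cardinality.
record IsAleph₁ (W : Set) : Set₁ where
  field
    uncountable : ℕ ≺ W
    least       : (A : Set) → ℕ ≺ A → W ↣ A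

record IsWellOrder {A : Set} (_<_ : Rel A 0ℓ) : Set where
  field
    isStrictTotalOrder : IsStrictTotalOrder _≡_ _<_
    wellFounded        : WellFounded _<_

Below : {A : Set} → Rel A 0ℓ → A → Set
Below {A} _<_ x = [ y ∈ A ∣ y < x ]

BelowOrder : {A : Set} (_<_ : Rel A 0ℓ) (x : A) → Rel (Below _<_ x) 0ℓ
BelowOrder _<_ x = _<_ on value

record IsCardinal {K : Set} (_<_ : Rel K 0ℓ) : Set where
  field
    isWellOrder : IsWellOrder _<_
    initial     : ∀ α → Below _<_ α ≺ K

Cofinal : {K : Set} → Rel K 0ℓ → Pred K 0ℓ → Set
Cofinal _<_ A = ∀ β → ∃[ α ] α ∈ A × (β ≡ α ⊎ β < α)

record IsRegularCardinal {K : Set} (_<_ : Rel K 0ℓ) : Set₁ where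
  field
    isCardinal : IsCardinal _<_
    infinite   : ℕ ↣ K
    regular    : (A : Pred K 0ℓ) → Cofinal _<_ A → [ α ∈ K ∣ A α ] ↔ K

record IsUltrafilter {K : Set} (𝓤 : Pred (Pred K 0ℓ) 0ℓ) : Set₁ where
  field
    whole  : Unary.U ∈ 𝓤
    proper : Unary.∅ ∉ 𝓤
    upward : ∀ {A B} → A ∈ 𝓤 → A ⊆ B → B ∈ 𝓤
    meet   : ∀ {A B} → A ∈ 𝓤 → B ∈ 𝓤 → (A ∩ B) ∈ 𝓤
    ultra  : ∀ A → A ∈ 𝓤 ⊎ ∁ A ∈ 𝓤

Uniform : {K : Set} → Pred (Pred K 0ℓ) 0ℓ → Set₁
Uniform {K} 𝓤 = ∀ A → A ∈ 𝓤 → [ α ∈ K ∣ A α ] ↔ K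

IndecomposableAt : {K : Set} → Set → Pred (Pred K 0ℓ) 0ℓ → Set₁
IndecomposableAt {K} M 𝓤 =
  (f : K → M) → ∃[ H ] ([ x ∈ M ∣ H x ] ≺ M) × (f ⊢ H) ∈ 𝓤

-- W stands for ℵ₁, so M ranges over the cardinalities in [ℵ₁, κ).
Indecomposable : {K : Set} → Set → Pred (Pred K 0ℓ) 0ℓ → Set₁
Indecomposable {K} W 𝓤 = (M : Set) → W ↣ M → M ≺ K → IndecomposableAt M 𝓤

record IsTree {T : Set} (_<ᵀ_ : Rel T 0ℓ) : Set where
  field
    isStrictPartialOrder : IsStrictPartialOrder _≡_ _<ᵀ_
    predsWellOrdered     : ∀ t → IsWellOrder (BelowOrder _<ᵀ_ t)

module _ {K : Set} (_<_ : Rel K 0ℓ) {T : Set} (_<ᵀ_ : Rel T 0ℓ) where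

  -- t ∈ Level α: the predecessors of t have order type α.
  Level : K → Pred T 0ℓ
  Level α t = ∃[ g ] IsOrderIsomorphism _≡_ _≡_
                       (BelowOrder _<ᵀ_ t) (BelowOrder _<_ α) g

  -- A tree has height κ when its non-empty levels are exactly those
  -- below κ.
  record HasHeightκ : Set where
    field
      bounded  : ∀ t → ∃[ α ] t ∈ Level α
      nonEmpty : ∀ α → ∃[ t ] t ∈ Level α

  record IsCofinalBranch (B : Pred T 0ℓ) : Set where
    field
      chain : ∀ {s t} → s ∈ B → t ∈ B → s <ᵀ t ⊎ s ≡ t ⊎ t <ᵀ s
      meets : ∀ α → ∃[ t ] t ∈ B × t ∈ Level α

  record IsAronszajn : Set₁ where
    field
      isTree      : IsTree _<ᵀ_
      height      : HasHeightκ
      smallLevels : ∀ α → [ t ∈ T ∣ Level α t ] ≺ K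
      noBranch    : ¬ (∃[ B ] IsCofinalBranch B)

  record IsAscentPath (f : K → ℕ → T) : Set where
    field
      onLevel : ∀ α i → f α i ∈ Level α
      ascent  : ∀ {α β} → α < β → ∃[ n ] ∀ i → n ≤ i → f α i <ᵀ f β i

𝟚^_ : Set → Set
𝟚^ A = A → Bool

{-# OPTIONS --safe #-}

module Submission where

-- Indecomposability makes every function on κ with fewer than κ values
-- countably valued modulo 𝓤, and since 2^ℵ₁ < κ there is e : κ → ω through
-- which all these functions factor modulo 𝓤.  Choose t γ on level γ.  The
-- projection of t γ to level α is a function of γ with fewer than κ values,
-- hence equal to f α (e γ) for almost all γ.
--
-- Let A α β = { i ∣ f α i <ᵀ f β i }, which is in e⁎𝓤 if α < β.  As β varies,
-- A α β is almost always φ α (e β), and as α varies, φ α is almost always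
-- Ψ (e α).  So for typical α and almost all β the set A α β is one of the
-- countably many Ψ k n.  Let x i lie in those Ψ k n with k , n < i that are in e⁎𝓤.  Two
-- typical α , β lie below some γ with A α γ and A β γ among the Ψ k n, so
-- f α (x i) and f β (x i) are below f γ (x i) for large i.  Projecting from
-- a typical level above α to level α gives the ascent path.

open import Defs
open import Axiom.ExcludedMiddle using (ExcludedMiddle)
open import Axiom.Extensionality.Propositional using (Extensionality; implicit-extensionality)
open import Data.Bool.Base using (Bool; true)
open import Data.Empty using (⊥; ⊥-elim)
open import Data.Fin.Properties using (toℕ-injective; 2↔Bool)
open import Data.Irrelevant using ([_])
open import Data.List.Base using (List; []; _∷_; lookup)
import Data.List.Membership.Propositional as List
open import Data.List.Relation.Unary.Any using (here; there; index)
open import Data.List.Relation.Unary.Any.Properties using (lookup-index)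
open import Data.Nat.Base as ℕ using (ℕ; zero; suc; _+_; _*_; _≤_; _≤′_; ≤′-refl; ≤′-step)
import Data.Nat.Properties as ℕ
open import Data.Product.Base using (_×_; ∃; ∃-syntax; _,_; proj₁; proj₂; uncurry)
open import Data.Product.Function.NonDependent.Propositional using (_×-↣_)
open import Data.Refinement.Base using (Refinement-syntax; value) renaming (_,_ to infixr 4 _,ʳ_)
open import Data.Refinement.Properties using (value-injective)
open import Data.Sum.Base using (_⊎_; inj₁; inj₂; [_,_]′)
open import Data.Sum.Function.Propositional using (_⊎-↣_)
open import Data.Unit.Base using (⊤; tt)
open import Function.Base using (_∘_; _on_; const)
open import Function.Bundles using (_↣_; mk↣; Injection)
open import Function.Construct.Composition using (_↣-∘_)
open import Function.Construct.Identity using (↣-id)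
open import Function.Construct.Symmetry using (↔-sym)
open import Function.Definitions using (Injective)
open import Function.Properties.Inverse using (↔⇒↣)
open import Induction.WellFounded using (WellFounded; module All; module FixPoint)
open import Level using (0ℓ)
open import Relation.Binary.Core using (Rel)
open import Relation.Binary.Definitions using (Tri; tri<; tri≈; tri>)
import Relation.Binary.Construct.On as On
open import Relation.Binary.Morphism.Structures using (IsOrderIsomorphism)
open import Relation.Binary.PropositionalEquality
  using (_≡_; _≢_; refl; sym; trans; cong; cong-app; subst; subst₂; isEquivalence; resp₂)
open import Relation.Binary.Structures using (IsStrictPartialOrder; IsStrictTotalOrder)
open import Relation.Nullary.Decidable.Core
  using (Dec; yes; no; does; recompute; decidable-stable)
open import Relation.Nullary.Negation.Core using (¬_; contradiction)
open import Relation.Unary using (Pred; _∈_; _⊢_)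
import Relation.Unary as Unary

open Injection using (to; injective)

-- Countable sets.

Countable : Set → Set
Countable A = A ↣ ℕ

value-↣ : {A : Set} {P : Pred A 0ℓ} → [ x ∈ A ∣ P x ] ↣ A
value-↣ = mk↣ value-injective

section-↣ : {A B : Set} (f : A → B) → (∀ b → ∃[ a ] f a ≡ b) → B ↣ A
section-↣ f s = mk↣ {to = proj₁ ∘ s} λ {x} {y} eq →
  trans (sym (proj₂ (s x))) (trans (cong f eq) (proj₂ (s y)))

↣-≺-trans : {A B C : Set} → A ↣ B → B ≺ C → A ≺ C
↣-≺-trans i (j , ¬k) = j ↣-∘ i , λ k → ¬k (i ↣-∘ k)

-- Pairs with the same sum s are coded in the interval [s², (s+1)²).
code : ℕ × ℕ → ℕ
code (m , n) = (m + n) * (m + n) + m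

code-mono : ∀ {m n m′ n′} → m + n ℕ.< m′ + n′ → code (m , n) ℕ.< code (m′ , n′)
code-mono {m} {n} {m′} {n′} s<s′ = begin-strict
  s * s + m              ≤⟨ ℕ.+-monoʳ-≤ (s * s) (ℕ.m≤m+n m n) ⟩
  s * s + s              ≡⟨ ℕ.+-comm (s * s) s ⟩
  s + s * s              ≡⟨ ℕ.*-suc s s ⟨
  s * suc s              <⟨ ℕ.m<n+m (s * suc s) ℕ.z<s ⟩
  suc s * suc s          ≤⟨ ℕ.*-mono-≤ s<s′ s<s′ ⟩
  s′ * s′                ≤⟨ ℕ.m≤m+n (s′ * s′) m′ ⟩
  s′ * s′ + m′           ∎
  where
  open ℕ.≤-Reasoning
  s = m + n
  s′ = m′ + n′

code-injective : Injective _≡_ _≡_ code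
code-injective {m , n} {m′ , n′} eq with ℕ.<-cmp (m + n) (m′ + n′)
... | tri< s<s′ _ _ = contradiction (code-mono {m} {n} {m′} {n′} s<s′) (ℕ.<-irrefl eq)
... | tri> _ _ s′<s = contradiction (code-mono {m′} {n′} {m} {n} s′<s) (ℕ.<-irrefl (sym eq))
... | tri≈ _ s≡s′ _
  with refl ← ℕ.+-cancelˡ-≡ ((m + n) * (m + n)) m m′
                (trans eq (cong (λ s → s * s + m′) (sym s≡s′)))
  with refl ← ℕ.+-cancelˡ-≡ m n n′ s≡s′ = refl

×-countable : {A B : Set} → Countable A → Countable B → Countable (A × B)
×-countable i j = mk↣ code-injective ↣-∘ (i ×-↣ j)

⊎-countable : {A B : Set} → Countable A → Countable B → Countable (A ⊎ B)
⊎-countable i j = mk↣ code-injective ↣-∘ (mk↣ tag-injective ↣-∘ (i ⊎-↣ j))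
  where
  tag : ℕ ⊎ ℕ → ℕ × ℕ
  tag (inj₁ n) = 0 , n
  tag (inj₂ n) = 1 , n
  tag-injective : Injective _≡_ _≡_ tag
  tag-injective {inj₁ _} {inj₁ _} refl = refl
  tag-injective {inj₂ _} {inj₂ _} refl = refl

Bool-countable : Countable Bool
Bool-countable = mk↣ toℕ-injective ↣-∘ ↔⇒↣ (↔-sym 2↔Bool)

⊤-countable : Countable ⊤
⊤-countable = mk↣ {to = const 0} λ _ → refl

module _ {A B : Set} (g : A → B) (countB : Countable B)
         (countFibre : ∀ b → Countable [ x ∈ A ∣ g x ≡ b ]) where

  private
    -- The indices `b` and `b′` are kept general so that their equation can be matched with `refl`;
    -- `g x ≡ g y` could not.
    locate : ∀ x y {b b′} (p : g x ≡ b) (q : g y ≡ b′) → b ≡ b′ →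
             to (countFibre b) (x ,ʳ [ p ]) ≡ to (countFibre b′) (y ,ʳ [ q ]) → x ≡ y
    locate x y {b} p q refl eq = cong value (injective (countFibre b) eq)

  union-countable : Countable A
  union-countable = mk↣ code-injective ↣-∘
    mk↣ {to = λ x → to countB (g x) , to (countFibre (g x)) (x ,ʳ [ refl ])}
      λ {x} {y} eq → locate x y refl refl
        (injective countB (cong proj₁ eq)) (cong proj₂ eq)

-- Orders and injections.

separated⇒injective : {A B : Set} {_<_ : Rel A 0ℓ} → IsStrictTotalOrder _≡_ _<_ →
  (f : A → B) → (∀ {x y} → x < y → f x ≢ f y) → Injective _≡_ _≡_ f
separated⇒injective sto f sep {x} {y} eq with IsStrictTotalOrder.compare sto x y
... | tri< x<y _ _ = contradiction eq (sep x<y)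
... | tri≈ _ x≡y _ = x≡y
... | tri> _ _ y<x = contradiction (sym eq) (sep y<x)

pullback : {A B : Set} {_<_ : Rel B 0ℓ} → IsWellOrder _<_ → (j : A ↣ B) →
           IsWellOrder (_<_ on to j)
pullback {_<_ = _<_} wo j = record
  { isStrictTotalOrder = record
    { isStrictPartialOrder = record
      { isEquivalence = isEquivalence
      ; irrefl        = irrefl ∘ cong (to j)
      ; trans         = <-trans
      ; <-resp-≈      = resp₂ _
      }
    ; compare = λ x y → refine (compare (to j x) (to j y))
    }
  ; wellFounded = On.wellFounded (to j) (IsWellOrder.wellFounded wo)
  }
  where
  open IsStrictTotalOrder (IsWellOrder.isStrictTotalOrder wo)
    using (irrefl; compare) renaming (trans to <-trans)
  refine : ∀ {x y} → Tri (to j x < to j y) (to j x ≡ to j y) (to j y < to j x) →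
           Tri (to j x < to j y) (x ≡ y) (to j y < to j x)
  refine (tri< a b c) = tri< a (b ∘ cong (to j)) c
  refine (tri≈ a b c) = tri≈ a (injective j b) c
  refine (tri> a b c) = tri> a (b ∘ cong (to j)) c

-- Choice, recursion and minimal elements in classical logic.

module Classical (em : ExcludedMiddle 0ℓ) (ext : Extensionality 0ℓ 0ℓ) where

  -- Excluded middle decides `P`, which turns the irrelevant membership proof into a usable one.
  member : {A : Set} {P : Pred A 0ℓ} (v : [ x ∈ A ∣ P x ]) → P (value v)
  member (_ ,ʳ [ p ]) = recompute em p

  truth : Set → Bool
  truth P = does (em {P})

  truth-intro : {P : Set} → P → truth P ≡ true
  truth-intro {P} p with em {P}
  ... | yes _ = refl
  ... | no ¬p = contradiction p ¬p

  truth-elim : {P : Set} → truth P ≡ true → P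
  truth-elim {P} eq with em {P}
  truth-elim eq | yes p = p

  -- A function is determined by its graph.
  →-↣-𝟚^ : {A B C : Set} → (A × B) ↣ C → (A → B) ↣ (𝟚^ C)
  →-↣-𝟚^ {A} {B} {C} j = mk↣ {to = graph} λ {f} {g} eq → ext (agree f g eq)
    where
    graph : (A → B) → 𝟚^ C
    graph f c = truth (∃[ a ] to j (a , f a) ≡ c)
    value-at : ∀ (g : A → B) {a b y} → (b , g b) ≡ (a , y) → y ≡ g a
    value-at g refl = refl
    agree : ∀ f g → graph f ≡ graph g → ∀ a → f a ≡ g a
    agree f g eq a = value-at g (injective j (proj₂ (truth-elim
      (trans (sym (cong-app eq (to j (a , f a)))) (truth-intro (a , refl))))))

  -- Elements are chosen one by one outside the finite list of earlier ones; a list that exhausted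
  -- `A` would make it countable.
  uncountable⇒ℕ↣ : {A : Set} → ¬ Countable A → ℕ ↣ A
  uncountable⇒ℕ↣ {A} unc =
    mk↣ (separated⇒injective ℕ.<-isStrictTotalOrder elem elem-distinct)
    where
    fresh : (xs : List A) → ∃[ x ] ¬ (x List.∈ xs)
    fresh xs with em {∃[ x ] ¬ (x List.∈ xs)}
    ... | yes p = p
    ... | no ¬p = contradiction
      (mk↣ toℕ-injective ↣-∘ section-↣ (lookup xs) λ x →
        index (all∈ x) , sym (lookup-index (all∈ x))) unc
      where
      all∈ : ∀ x → x List.∈ xs
      all∈ x = decidable-stable em λ x∉xs → ¬p (x , x∉xs)

    initial : ℕ → List A
    initial zero    = []
    initial (suc n) = proj₁ (fresh (initial n)) ∷ initial n

    elem : ℕ → A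
    elem n = proj₁ (fresh (initial n))

    elem∈initial : ∀ {m n} → suc m ≤′ n → elem m List.∈ initial n
    elem∈initial ≤′-refl       = here refl
    elem∈initial (≤′-step m<n) = there (elem∈initial m<n)

    elem-distinct : ∀ {m n} → m ℕ.< n → elem m ≢ elem n
    elem-distinct {m} {n} m<n eq = proj₂ (fresh (initial n))
      (subst (List._∈ initial n) eq (elem∈initial (ℕ.≤⇒≤′ m<n)))

  abstract
    -- The recursion is packed with its unfolding equation and kept abstract, so that proofs unfold
    -- it by rewriting, only at the stage they concern.
    wfFix : {A : Set} {_<_ : Rel A 0ℓ} → WellFounded _<_ → {P : A → Set}
      (step : ∀ x → (∀ {y} → y < x → P y) → P x) →
      ∃ λ (F : ∀ x → P x) → ∀ x → F x ≡ step x (λ {y} _ → F y)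
    wfFix {_<_ = _<_} wf {P} step = All.wfRec wf 0ℓ P step , λ _ → unfold-wfRec
      where
      open FixPoint wf P step
        (λ x eq → cong (step x) (implicit-extensionality ext (ext eq)))

  least : {A : Set} {_<_ : Rel A 0ℓ} → WellFounded _<_ → (P : Pred A 0ℓ) →
    ∀ x → P x → ∃[ m ] P m × (∀ {y} → y < m → ¬ P y)
  least {_<_ = _<_} wf P = All.wfRec wf 0ℓ _ descend
    where
    descend : ∀ x → (∀ {y} → y < x → P y → ∃[ m ] P m × (∀ {y} → y < m → ¬ P y)) →
              P x → ∃[ m ] P m × (∀ {y} → y < m → ¬ P y)
    descend x IH px with em {∃[ y ] y < x × P y}
    ... | yes (y , y<x , py) = IH y<x py
    ... | no none            = x , px , λ y<x py → none (_ , y<x , py)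

  -- Comparability of subsets of a well-order.

  module WellOrder {K : Set} {_<_ : Rel K 0ℓ} (wo : IsWellOrder _<_) where

    open IsWellOrder wo
    open IsStrictTotalOrder isStrictTotalOrder
      using (compare) renaming (trans to <-trans)

    -- c x is the least element of K not among the c y with y < x: the
    -- Mostowski collapse, as long as K is not exhausted.
    module Collapse {X : Set} (j : X ↣ K) where

      private
        Free : ∀ x → (∀ {y} → to j y < to j x → K) → Pred K 0ℓ
        Free x IH z = ∀ {y} (p : to j y < to j x) → IH p ≢ z

        step : ∀ x → (∀ {y} → to j y < to j x → K) → K
        step x IH with em {∃[ z ] Free x IH z}
        ... | yes (z , free) = proj₁ (least wellFounded (Free x IH) z free)
        -- Arbitrary value once `K` is exhausted; the free `z` in `c-least` rules this case out.
        ... | no _           = to j x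

        fix : ∃ λ (c : X → K) → ∀ x → c x ≡ step x (λ {y} _ → c y)
        fix = wfFix (On.wellFounded (to j) wellFounded) step

      c : X → K
      c = proj₁ fix

      c-least : ∀ x z → (∀ {y} → to j y < to j x → c y ≢ z) →
                (∀ {y} → to j y < to j x → c y ≢ c x) × ¬ (z < c x)
      c-least x z free rewrite proj₂ fix x with em {∃[ z ] Free x (λ {y} _ → c y) z}
      ... | no none         = contradiction (z , λ {y} → free {y}) none
      ... | yes (z′ , free′)
        with m , free″ , min ← least wellFounded (Free x (λ {y} _ → c y)) z′ free′
        = (λ {y} → free″ {y}) , λ z<m → min z<m (λ {y} → free {y})

    -- If the collapse misses some `α` in `P`, then `α` stays free at every stage, so all values are
    -- below `α`. Otherwise choosing preimages embeds `P` into `X`.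
    comparability : {X : Set} → X ↣ K → (P : Pred K 0ℓ) →
      ([ α ∈ K ∣ P α ] ↣ X) ⊎ (∃[ α ] P α × (X ↣ Below _<_ α))
    comparability {X} j P = decide em
      where
      open Collapse j
      decide : Dec (∃[ α ] P α × (∀ x → c x ≢ α)) → _
      decide (yes (α , pα , missed)) = inj₂ (α , pα ,
        mk↣ {to = λ x → c x ,ʳ [ c<α x ]}
          (separated⇒injective (IsWellOrder.isStrictTotalOrder (pullback wo j)) c
            (λ {x} {y} x<y → proj₁ (c-least y α λ _ → missed _) x<y) ∘ cong value))
        where
        c<α : ∀ x → c x < α
        c<α x with compare (c x) α
        ... | tri< lt _ _ = lt
        ... | tri≈ _ eq _ = contradiction eq (missed x)
        ... | tri> _ _ gt = contradiction gt (proj₂ (c-least x α λ _ → missed _))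
      decide (no hit) = inj₁ (mk↣ {to = proj₁ ∘ preimage} λ {v} {w} eq →
        value-injective (trans (sym (proj₂ (preimage v)))
                               (trans (cong c eq) (proj₂ (preimage w)))))
        where
        preimage : (v : [ α ∈ K ∣ P α ]) → ∃[ x ] c x ≡ value v
        preimage v = decidable-stable em λ none →
          hit (value v , member v , λ x eq → none (x , eq))

    -- If `h x` were below `x`, monotonicity would put `h (h x)` below `h x`, and so on in an
    -- infinite descent.
    expanding : ∀ {β} (h : Below _<_ β → K) →
      (∀ {x y} → value x < value y → h x < h y) → ∀ x → ¬ (h x < value x)
    expanding {β} h mono x = All.wfRec wellFounded 0ℓ
      (λ α → (α<β : α < β) → ¬ (h (α ,ʳ [ α<β ]) < α))
      (λ α IH α<β hα<α → IH hα<α (<-trans hα<α α<β) (mono hα<α))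
      (value x) (member x)

  -- The order type ω₁.

  -- I carries the order pulled back from K along j, of type ω₁.
  record IsOmega₁ {K : Set} (_<_ : Rel K 0ℓ) {I : Set} (j : I ↣ K) : Set where
    field
      uncountable : ¬ Countable I
      segments    : ∀ i → Countable (Below (_<_ on to j) i)

  module _ {K : Set} {_<_ : Rel K 0ℓ} (wo : IsWellOrder _<_) where

    -- If some proper segment of `W` is uncountable, the least such segment has only countable
    -- segments itself; otherwise `W` will do.
    omega₁-within : {W : Set} → W ↣ K → ¬ Countable W →
                    ∃[ I ] ∃ λ (i : I ↣ W) → ∃ λ (j : I ↣ K) → IsOmega₁ _<_ j
    omega₁-within {W} w unc with em {∃[ x ] ¬ Countable (Below (_<_ on to w) x)}
    ... | no none = W , ↣-id W , w , record
      { uncountable = unc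
      ; segments    = λ x → decidable-stable em λ ¬c → none (x , ¬c)
      }
    ... | yes (x , ¬c)
      with m , ¬cm , min ← least (IsWellOrder.wellFounded (pullback wo w)) _ x ¬c
      = Below (_<_ on to w) m , value-↣ , w ↣-∘ value-↣ , record
      { uncountable = ¬cm
      ; segments    = λ y → decidable-stable em λ ¬c →
          min (member y) λ c → ¬c (c ↣-∘ mk↣ {to = λ z → value (value z) ,ʳ [ member z ]}
            (value-injective ∘ value-injective ∘ cong value))
      }

    module Omega₁ {I : Set} {j : I ↣ K} (ω₁ : IsOmega₁ _<_ j) where

      open IsOmega₁ ω₁
      open IsWellOrder (pullback wo j)
      open IsStrictTotalOrder isStrictTotalOrder using (compare; irrefl; asym)

      infix 4 _⊏_
      _⊏_ : Rel I 0ℓ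
      _⊏_ = _<_ on to j

      closed-segments : ∀ d → Countable [ i ∈ I ∣ ¬ d ⊏ i ]
      closed-segments d = ⊎-countable (segments d) ⊤-countable ↣-∘ section-↣ f surj
        where
        f : Below _⊏_ d ⊎ ⊤ → [ i ∈ I ∣ ¬ d ⊏ i ]
        f (inj₁ y) = value y ,ʳ [ asym (member y) ]
        f (inj₂ _) = d ,ʳ [ irrefl refl ]
        surj : ∀ v → ∃[ x ] f x ≡ v
        surj v with compare (value v) d
        ... | tri< v<d _ _ = inj₁ (value v ,ʳ [ v<d ]) , refl
        ... | tri≈ _ v≡d _ = inj₂ tt , value-injective (sym v≡d)
        ... | tri> _ _ d<v = contradiction d<v (member v)

      -- Regularity of ω₁: if `d` were unbounded, the closed segments up to the `d c` would cover
      -- `I`, a countable union of countable sets.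
      countable-bounded : {C : Set} → Countable C → (d : C → I) → ∃[ δ ] ∀ c → d c ⊏ δ
      countable-bounded {C} count d = decidable-stable em λ none →
        let above : ∀ δ → ∃[ c ] ¬ d c ⊏ δ
            above δ = decidable-stable em λ ¬a →
              none (δ , λ c → decidable-stable em λ ¬lt → ¬a (c , ¬lt))
        in uncountable (union-countable (proj₁ ∘ above) count λ c →
             closed-segments (d c) ↣-∘
             mk↣ {to = λ v → value v ,ʳ
                    [ subst (λ c → ¬ d c ⊏ value v) (member v) (proj₂ (above (value v))) ]}
               (value-injective ∘ cong value))

      -- The rows `c i` are chosen by recursion: those before `i` use up only countably many
      -- elements, so a copy of ℕ is left for row `i`.
      ×ℕ-↣ : (I × ℕ) ↣ I
      ×ℕ-↣ = mk↣ {to = uncurry c} λ {x} {y} → c-injective {x} {y}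
        where
        Free : ∀ i → (∀ {k} → k ⊏ i → ℕ → I) → Pred I 0ℓ
        Free i IH z = ∀ {k} (p : k ⊏ i) m → IH p m ≢ z

        step : ∀ i → (∀ {k} → k ⊏ i → ℕ → I) → ℕ → I
        step i IH with em {ℕ ↣ [ z ∈ I ∣ Free i IH z ]}
        ... | yes s = value ∘ to s
        -- Dummy row; `free-uncountable` excludes this case in `c-spec`.
        ... | no _  = const i

        fix : ∃ λ (c : I → ℕ → I) → ∀ i → c i ≡ step i (λ {k} _ → c k)
        fix = wfFix wellFounded step

        c : I → ℕ → I
        c = proj₁ fix

        free-uncountable : ∀ i → ¬ Countable [ z ∈ I ∣ Free i (λ {k} _ → c k) z ]
        free-uncountable i count = uncountable
          (⊎-countable count (×-countable (segments i) (↣-id ℕ)) ↣-∘ section-↣ f surj)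
          where
          f : [ z ∈ I ∣ Free i (λ {k} _ → c k) z ] ⊎ (Below _⊏_ i × ℕ) → I
          f (inj₁ z)       = value z
          f (inj₂ (k , m)) = c (value k) m
          surj : ∀ z → ∃[ x ] f x ≡ z
          surj z with em {∃[ k ] ∃[ m ] k ⊏ i × c k m ≡ z}
          ... | yes (k , m , k<i , eq) = inj₂ ((k ,ʳ [ k<i ]) , m) , eq
          ... | no none = inj₁ (z ,ʳ [ (λ k<i m eq → none (_ , m , k<i , eq)) ]) , refl

        c-spec : ∀ i → Injective _≡_ _≡_ (c i) × (∀ {k} → k ⊏ i → ∀ m n → c k m ≢ c i n)
        c-spec i rewrite proj₂ fix i with em {ℕ ↣ [ z ∈ I ∣ Free i (λ {k} _ → c k) z ]}
        ... | yes s = injective s ∘ value-injective ,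
                      λ k<i m n → member (to s n) k<i m
        ... | no ¬s = contradiction (uncountable⇒ℕ↣ (free-uncountable i)) ¬s

        c-injective : Injective _≡_ _≡_ (uncurry c)
        c-injective {i , m} {k , n} eq with compare i k
        ... | tri< i<k _ _    = contradiction eq (proj₂ (c-spec k) i<k m n)
        ... | tri≈ _ refl _   = cong (i ,_) (proj₁ (c-spec i) eq)
        ... | tri> _ _ k<i    = contradiction (sym eq) (proj₂ (c-spec i) k<i n m)

      -- Padding with 0 gives all initial parts the same type `I → ℕ`. The argument is a partial
      -- function because the recursion behind `finest` supplies only earlier values.
      trunc : ∀ i → (∀ {k} → k ⊏ i → ℕ) → I → ℕ
      trunc i h k with em {k ⊏ i}
      ... | yes k<i = h k<i
      ... | no _    = 0

      restrict : I → (I → ℕ) → I → ℕ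
      restrict i h = trunc i (λ {k} _ → h k)

      restrict-⊏ : ∀ {i k} → k ⊏ i → ∀ h → restrict i h k ≡ h k
      restrict-⊏ {i} {k} k<i h with em {k ⊏ i}
      ... | yes _   = refl
      ... | no k≮i = contradiction k<i k≮i

      difference : ∃ λ (d : (I → ℕ) → (I → ℕ) → I) → ∀ (x y : I → ℕ) → x (d x y) ≡ y (d x y) → x ≡ y
      difference = (λ x y → proj₁ (diff x y)) , λ x y → proj₂ (diff x y)
        where
        diff : ∀ (x y : I → ℕ) → ∃[ i ] (x i ≡ y i → x ≡ y)
        diff x y with em {∃[ i ] x i ≢ y i}
        ... | yes (i , x≢y) = i , λ eq → contradiction eq x≢y
        -- Without a point of difference any index serves, and the uncountable `I` has one.
        ... | no none       = to (uncountable⇒ℕ↣ uncountable) 0 ,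
                              λ _ → ext λ i → decidable-stable em λ x≢y → none (i , x≢y)

      -- One point of difference for each of the countably many pairs gives a countable set of
      -- indices, which is bounded by some `δ`.
      countable-separated : {H : Pred (I → ℕ) 0ℓ} → Countable [ x ∈ (I → ℕ) ∣ H x ] →
        ∃[ δ ] ∀ {x y} → x ∈ H → y ∈ H → restrict δ x ≡ restrict δ y → x ≡ y
      countable-separated count
        with d , d-spec ← difference
        with δ , d<δ ← countable-bounded (×-countable count count)
                         (λ (x , y) → d (value x) (value y))
        = δ , λ {x} {y} x∈H y∈H eq →
            let lt = d<δ ((x ,ʳ [ x∈H ]) , (y ,ʳ [ y∈H ]))
            in d-spec x y (trans (sym (restrict-⊏ lt x))
                 (trans (cong-app eq (d x y)) (restrict-⊏ lt y)))

  -- Levels of a tree.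

  module Tree {K : Set} {_<_ : Rel K 0ℓ} (wo : IsWellOrder _<_)
              {T : Set} {_<ᵀ_ : Rel T 0ℓ} (isTree : IsTree _<ᵀ_) where

    open IsTree isTree
    open IsStrictPartialOrder isStrictPartialOrder using () renaming (trans to ᵀ-trans)
    open IsStrictTotalOrder (IsWellOrder.isStrictTotalOrder wo)
      using () renaming (trans to <-trans)
    open WellOrder wo using (expanding)

    module LevelOf {α : K} {t : T} (t∈α : Level _<_ _<ᵀ_ α t) where

      rank : Below _<ᵀ_ t → Below _<_ α
      rank = proj₁ t∈α

      open IsOrderIsomorphism (proj₂ t∈α) public
        using (mono; cancel) renaming (injective to rank-injective)

      unrank : Below _<_ α → Below _<ᵀ_ t
      unrank x = proj₁ (IsOrderIsomorphism.surjective (proj₂ t∈α) x)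

      rank-unrank : ∀ x → rank (unrank x) ≡ x
      rank-unrank x = proj₂ (IsOrderIsomorphism.surjective (proj₂ t∈α) x) refl

      unrank-mono : ∀ {x y} → value x < value y → value (unrank x) <ᵀ value (unrank y)
      unrank-mono {x} {y} x<y = cancel {unrank x} {unrank y}
        (subst₂ (_<_ on value) (sym (rank-unrank x)) (sym (rank-unrank y)) x<y)

    -- The node of rank `α` below `t` is the one sought: the ranking of the nodes below `t`
    -- restricts to an isomorphism from its predecessors onto the segment below `α`.
    predecessor : ∀ {α β t} → α < β → Level _<_ _<ᵀ_ β t →
                  ∃[ s ] Level _<_ _<ᵀ_ α s × s <ᵀ t
    predecessor {α} {β} {t} α<β t∈β = value ŝ , (rank↾ , iso) , member ŝ
      where
      open LevelOf t∈β

      below-α : Below _<_ α → Below _<_ β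
      below-α z = value z ,ʳ [ <-trans (member z) α<β ]

      ŝ : Below _<ᵀ_ t
      ŝ = unrank (α ,ʳ [ α<β ])

      below-s : Below _<ᵀ_ (value ŝ) → Below _<ᵀ_ t
      below-s y = value y ,ʳ [ ᵀ-trans (member y) (member ŝ) ]

      rank<α : ∀ y → value (rank (below-s y)) < α
      rank<α y = subst (value (rank (below-s y)) <_) (cong value (rank-unrank _))
                       (mono {below-s y} {ŝ} (member y))

      rank↾ : Below _<ᵀ_ (value ŝ) → Below _<_ α
      rank↾ y = value (rank (below-s y)) ,ʳ [ rank<α y ]

      unrank↾ : Below _<_ α → Below _<ᵀ_ (value ŝ)
      unrank↾ z = value (unrank (below-α z)) ,ʳ [ unrank-mono (member z) ]

      iso : IsOrderIsomorphism _≡_ _≡_ (BelowOrder _<ᵀ_ (value ŝ)) (BelowOrder _<_ α) rank↾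
      iso = record
        { isOrderMonomorphism = record
          { isOrderHomomorphism = record
            { cong = cong rank↾
            ; mono = λ {x} {y} → mono {below-s x} {below-s y}
            }
          ; injective = λ eq → value-injective
              (cong value (rank-injective (value-injective (cong value eq))))
          ; cancel = λ {x} {y} → cancel {below-s x} {below-s y}
          }
        ; surjective = λ z → unrank↾ z , λ where
            refl → value-injective (cong value (rank-unrank (below-α z)))
        }

    -- Such an inclusion would induce an order-preserving map from the segment below `α′` to that
    -- below `α`, moving `α` down, against `expanding`.
    level-below : ∀ {α α′ s s′} → α < α′ → Level _<_ _<ᵀ_ α s → Level _<_ _<ᵀ_ α′ s′ →
                  ¬ (∀ {y} → y <ᵀ s′ → y <ᵀ s)
    level-below {α} {α′} {s} {s′} α<α′ s∈α s′∈α′ sub =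
      expanding (value ∘ h) h-mono (α ,ʳ [ α<α′ ]) (member (h (α ,ʳ [ α<α′ ])))
      where
      module S = LevelOf s∈α
      module S′ = LevelOf s′∈α′
      include : Below _<ᵀ_ s′ → Below _<ᵀ_ s
      include y = value y ,ʳ [ sub (member y) ]
      h : Below _<_ α′ → Below _<_ α
      h x = S.rank (include (S′.unrank x))
      h-mono : ∀ {x y} → value x < value y → value (h x) < value (h y)
      h-mono {x} {y} x<y =
        S.mono {include (S′.unrank x)} {include (S′.unrank y)} (S′.unrank-mono x<y)

    -- Predecessors of `u` are comparable, and in the two wrong cases every predecessor of `s′`
    -- would lie below `s`, against `level-below`.
    below-common : ∀ {α α′ s s′ u} → α < α′ → Level _<_ _<ᵀ_ α s → Level _<_ _<ᵀ_ α′ s′ →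
                   s <ᵀ u → s′ <ᵀ u → s <ᵀ s′
    below-common {u = u} α<α′ s∈α s′∈α′ s<u s′<u
      with IsStrictTotalOrder.compare (IsWellOrder.isStrictTotalOrder (predsWellOrdered u))
             (_ ,ʳ [ s<u ]) (_ ,ʳ [ s′<u ])
    ... | tri< s<s′ _ _ = s<s′
    ... | tri≈ _ refl _ = ⊥-elim (level-below α<α′ s∈α s′∈α′ λ y<s → y<s)
    ... | tri> _ _ s′<s = ⊥-elim (level-below α<α′ s∈α s′∈α′ λ y<s′ → ᵀ-trans y<s′ s′<s)

  -- Functions modulo an ultrafilter.

  module Ultrafilter {K : Set} {𝓤 : Pred (Pred K 0ℓ) 0ℓ} (isU : IsUltrafilter 𝓤) where

    open IsUltrafilter isU

    inhabited : ∀ {A} → A ∈ 𝓤 → ∃[ γ ] A γ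
    inhabited A∈𝓤 = decidable-stable em λ none → proper (upward A∈𝓤 λ a → none (_ , a))

    infix 4 _≼_
    -- Equivalently, on some set in `𝓤` the partition of `K` by `g` refines the one by `f`.
    record _≼_ {A B : Set} (f : K → A) (g : K → B) : Set where
      constructor via
      field
        factor  : B → A
        factors : (λ γ → f γ ≡ factor (g γ)) ∈ 𝓤

    open _≼_

    ≼-trans : {A B C : Set} {f : K → A} {g : K → B} {h : K → C} → f ≼ g → g ≼ h → f ≼ h
    ≼-trans (via φ f≡φg) (via ψ g≡ψh) =
      via (φ ∘ ψ) (upward (meet f≡φg g≡ψh) λ (p , q) → trans p (cong φ q))

    determined⇒≼ : {A B : Set} {f : K → A} {g : K → B} {S : Pred K 0ℓ} → S ∈ 𝓤 →
      (∀ {γ δ} → S γ → S δ → g γ ≡ g δ → f γ ≡ f δ) → f ≼ g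
    determined⇒≼ {A} {B} {f} {g} {S} S∈𝓤 det = via φ (upward S∈𝓤 φ-correct)
      where
      φ : B → A
      φ b with em {∃[ γ ] S γ × g γ ≡ b}
      ... | yes (γ , _) = f γ
      -- A `b` not attained on `S` gets an arbitrary value, available because `S`, being in `𝓤`, is
      -- not empty.
      ... | no _        = f (proj₁ (inhabited S∈𝓤))
      φ-correct : ∀ {γ} → S γ → f γ ≡ φ (g γ)
      φ-correct {γ} s with em {∃[ δ ] S δ × g δ ≡ g γ}
      ... | yes (δ , s′ , eq) = det s s′ (sym eq)
      ... | no none           = contradiction (γ , s , refl) none

    corestrict : {M : Set} (f : K → M) {H : Pred M 0ℓ} → (f ⊢ H) ∈ 𝓤 →
      ∃ λ (f′ : K → [ x ∈ M ∣ H x ]) → (λ γ → value (f′ γ) ≡ f γ) ∈ 𝓤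
    corestrict {M} f {H} f∈H = f′ , upward f∈H f′-correct
      where
      f′ : K → [ x ∈ M ∣ H x ]
      f′ γ with em {H (f γ)} | inhabited f∈H
      ... | yes p | _      = f γ ,ʳ [ p ]
      ... | no _  | δ , p  = f δ ,ʳ [ p ]
      f′-correct : ∀ {γ} → H (f γ) → value (f′ γ) ≡ f γ
      f′-correct {γ} p with em {H (f γ)}
      ... | yes _ = refl
      ... | no ¬p = contradiction p ¬p

    finite-meet : (Q : ℕ → Pred K 0ℓ) → (∀ n → Q n ∈ 𝓤) →
                  ∀ i → (λ γ → ∀ n → n ℕ.< i → Q n γ) ∈ 𝓤
    finite-meet Q Q∈𝓤 zero    = upward whole λ _ _ ()
    finite-meet Q Q∈𝓤 (suc i) = upward (meet (finite-meet Q Q∈𝓤 i) (Q∈𝓤 i))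
      λ (below , q) n n<1+i → [ below n , (λ { refl → q }) ]′ (ℕ.m<1+n⇒m<n∨m≡n n<1+i)

    -- Each `x i` has to meet only finitely many sets. Those not in the image ultrafilter are made
    -- vacuous in `Large`, so that one finite meet handles all pairs.
    pseudo-intersection : (e : K → ℕ) (Q : ℕ → ℕ → Pred ℕ 0ℓ) →
      ∃ λ (x : ℕ → ℕ) → ∀ {i k n} → k ℕ.< i → n ℕ.< i → (e ⊢ Q k n) ∈ 𝓤 → Q k n (x i)
    pseudo-intersection e Q =
      (λ i → e (proj₁ (common i))) , λ {i} k<i n<i → proj₂ (common i) _ k<i _ n<i
      where
      Large : ℕ → ℕ → Pred K 0ℓ
      Large k n γ = (e ⊢ Q k n) ∈ 𝓤 → Q k n (e γ)
      large : ∀ k n → Large k n ∈ 𝓤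
      large k n with em {(e ⊢ Q k n) ∈ 𝓤}
      ... | yes p = upward p λ q _ → q
      ... | no ¬p = upward whole λ _ p → contradiction p ¬p
      common : ∀ i → ∃[ γ ] (∀ k → k ℕ.< i → ∀ n → n ℕ.< i → Large k n γ)
      common i = inhabited
        (finite-meet _ (λ k → finite-meet (Large k) (large k) i) i)

    -- Indecomposability and a finest countably valued function.

    module IndecomposableUltrafilter
      {_<_ : Rel K 0ℓ} (card : IsCardinal _<_) {W : Set} (aleph : IsAleph₁ W)
      (2^W≺K : (𝟚^ W) ≺ K) (indec : Indecomposable W 𝓤) where

      open IsCardinal card
      open IsWellOrder isWellOrder using (wellFounded)
      open WellOrder isWellOrder using (comparability)
      open IsAleph₁ aleph using () renaming (uncountable to ℕ≺W; least to W-least)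

      -- Induction on the bound `α` for the size of `M`. For uncountable `M`, indecomposability
      -- yields a smaller `H`, into which the segment below `α` cannot embed; so `H` fits below some
      -- `β < α`.
      concentrated-below : ∀ α {M : Set} → M ↣ Below _<_ α → (f : K → M) →
        ∃[ H ] Countable [ x ∈ M ∣ H x ] × (f ⊢ H) ∈ 𝓤
      concentrated-below = All.wfRec wellFounded _ _ induct
        where
        induct : ∀ α → (∀ {β} → β < α → {M : Set} → M ↣ Below _<_ β → (f : K → M) →
                   ∃[ H ] Countable [ x ∈ M ∣ H x ] × (f ⊢ H) ∈ 𝓤) →
                 {M : Set} → M ↣ Below _<_ α → (f : K → M) →
                 ∃[ H ] Countable [ x ∈ M ∣ H x ] × (f ⊢ H) ∈ 𝓤
        induct α IH {M} i f with em {Countable M}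
        ... | yes count = Unary.U , count ↣-∘ value-↣ , whole
        ... | no unc
          with H , ([H]↣M , M↣̸[H]) , f∈H ←
                 indec M (W-least M (uncountable⇒ℕ↣ unc , unc)) (↣-≺-trans i (initial α)) f
          with comparability (value-↣ ↣-∘ (i ↣-∘ [H]↣M)) (_< α)
        ... | inj₁ k = contradiction (k ↣-∘ i) M↣̸[H]
        ... | inj₂ (β , β<α , k)
          with f′ , f′≡f ← corestrict f f∈H
          with H′ , count , f′∈H′ ← IH β<α k f′
          = (λ x → ∃[ v ] H′ v × value v ≡ x)
          , count ↣-∘ section-↣ (λ v → value (value v) ,ʳ [ value v , member v , refl ])
              (λ x → let v , h , eq = member x in (v ,ʳ [ h ]) , value-injective eq)
          , upward (meet f′≡f f′∈H′) λ (eq , h) → _ , h , eq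

      concentrated : ∀ {M} → M ≺ K → (f : K → M) →
        ∃[ H ] Countable [ x ∈ M ∣ H x ] × (f ⊢ H) ∈ 𝓤
      concentrated (i , K↣̸M) f with comparability i Unary.U
      ... | inj₁ k           = contradiction (k ↣-∘ mk↣ {to = _,ʳ [ tt ]} (cong value)) K↣̸M
      ... | inj₂ (α , _ , k) = concentrated-below α k f

      essentially-countable : ∀ {M} → M ≺ K → (f : K → M) → ∃ λ (e : K → ℕ) → f ≼ e
      essentially-countable M≺K f
        with H , count , f∈H ← concentrated M≺K f
        with f′ , f′≡f ← corestrict f f∈H
        = to count ∘ f′ , determined⇒≼ f′≡f λ p q eq →
            trans (sym p) (trans (cong value (injective count eq)) q)

      -- An element of `W`, viewed as a function on `⊤`, has a singleton as its coded graph; so `W`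
      -- embeds into its power set.
      W↣K : W ↣ K
      W↣K = proj₁ 2^W≺K ↣-∘ (→-↣-𝟚^ {⊤} (mk↣ {to = proj₂} λ { refl → refl })
                         ↣-∘ mk↣ {to = const} λ eq → cong-app eq tt)

      →-≺ : {A B : Set} → (A × B) ↣ W → (A → B) ≺ K
      →-≺ i = ↣-≺-trans (→-↣-𝟚^ i) 2^W≺K

      -- Otherwise each function on K with fewer than |K| values could be
      -- properly refined, and ω₁ successive refinements F would together take
      -- only 2^ℵ₁ < κ values.  Countably many of these values suffice, and
      -- they are already told apart before some stage δ, so that F δ is not a
      -- proper refinement.
      finest : ∃ λ (e : K → ℕ) → ∀ (f : K → ℕ) → f ≼ e
      finest = decidable-stable em λ none →
        let I , i , j , ω₁ = omega₁-within isWellOrder W↣K (proj₂ ℕ≺W)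
        in absurd none ω₁ i
        where
        module _ (none : ¬ ∃ λ (e : K → ℕ) → ∀ (f : K → ℕ) → f ≼ e)
                 {I : Set} {j : I ↣ K} (ω₁ : IsOmega₁ _<_ j) (i : I ↣ W) where

          open Omega₁ isWellOrder ω₁

          I→ℕ≺K : (I → ℕ) ≺ K
          I→ℕ≺K = →-≺ (i ↣-∘ ×ℕ-↣)

          -- By `none`, some `f` does not factor through the countably valued `e` above `r`; hence
          -- it does not factor through `r`.
          refinement : (r : K → (I → ℕ)) → ∃ λ (f : K → ℕ) → ¬ f ≼ r
          refinement r = decidable-stable em λ ¬f →
            let e , r≼e = essentially-countable I→ℕ≺K r
            in none (e , λ f → decidable-stable em λ f⋠e →
                 ¬f (f , λ f≼r → f⋠e (≼-trans f≼r r≼e)))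

          step : ∀ δ → (∀ {k} → k ⊏ δ → K → ℕ) → K → ℕ
          step δ IH = proj₁ (refinement λ γ → trunc δ λ k⊏δ → IH k⊏δ γ)

          fix : ∃ λ (F : I → K → ℕ) → ∀ δ → F δ ≡ step δ (λ {k} _ → F k)
          fix = wfFix (IsWellOrder.wellFounded (pullback isWellOrder j)) step

          F : I → K → ℕ
          F = proj₁ fix

          R : K → (I → ℕ)
          R γ δ = F δ γ

          absurd : ⊥
          absurd =
            let H , count , R∈H = concentrated I→ℕ≺K R
                δ , separated   = countable-separated count
            in proj₂ (refinement (restrict δ ∘ R)) (subst (_≼ (restrict δ ∘ R)) (proj₂ fix δ)
                 (determined⇒≼ R∈H λ p q eq → cong-app (separated p q eq) δ))

      finest-small : ∃ λ (e : K → ℕ) → ∀ {M} → M ≺ K → (f : K → M) → f ≼ e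
      finest-small = let e , fine = finest in e , λ M≺K f →
        let e′ , f≼e′ = essentially-countable M≺K f in ≼-trans f≼e′ (fine e′)

  -- Regularity and uniformity.

  module Regular {K : Set} {_<_ : Rel K 0ℓ} (reg : IsRegularCardinal _<_) where

    open IsRegularCardinal reg
    open IsCardinal isCardinal
    open IsStrictTotalOrder (IsWellOrder.isStrictTotalOrder isWellOrder)
      using (compare) renaming (trans to <-trans)

    -- If `α` were the largest element, the singleton of `α` would be cofinal, hence of the size of
    -- the infinite `K`.
    unbounded : ∀ α → ∃[ β ] α < β
    unbounded α = decidable-stable em λ none →
      ℕ.0≢1+n {0} (injective infinite (injective (↔⇒↣ (↔-sym (regular (_≡ α) (cofinal none))))
        (same _ _)))
      where
      same : (v w : [ β ∈ K ∣ β ≡ α ]) → v ≡ w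
      same v w = value-injective (trans (member v) (sym (member w)))

      cofinal : ¬ (∃[ β ] α < β) → Cofinal _<_ (_≡ α)
      cofinal none β with compare β α
      ... | tri< β<α _ _ = α , refl , inj₂ β<α
      ... | tri≈ _ β≡α _ = α , refl , inj₁ β≡α
      ... | tri> _ _ α<β = contradiction (β , α<β) none

    -- The complement of a tail lies below some `β`, so it has size less than κ and uniformity keeps
    -- it out of `𝓤`.
    tails : {𝓤 : Pred (Pred K 0ℓ) 0ℓ} → IsUltrafilter 𝓤 → Uniform 𝓤 → ∀ α → (α <_) ∈ 𝓤
    tails isU uniform α with IsUltrafilter.ultra isU (α <_)
    ... | inj₁ tail = tail
    ... | inj₂ bounded with β , α<β ← unbounded α =
      contradiction (mk↣ {to = λ v → value v ,ʳ [ below (member v) ]}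
                       (value-injective ∘ cong value)
                     ↣-∘ ↔⇒↣ (↔-sym (uniform _ bounded)))
                    (proj₂ (initial β))
      where
      below : ∀ {γ} → ¬ α < γ → γ < β
      below {γ} α≮γ with compare γ β
      ... | tri< γ<β _ _ = γ<β
      ... | tri≈ _ refl _ = contradiction α<β α≮γ
      ... | tri> _ _ β<γ = contradiction (<-trans α<β β<γ) α≮γ

  -- Construction of the ascent path.

  module AscentPath {K : Set} {_<_ : Rel K 0ℓ} (reg : IsRegularCardinal _<_)
    {W : Set} (aleph : IsAleph₁ W) (2^W≺K : (𝟚^ W) ≺ K)
    {𝓤 : Pred (Pred K 0ℓ) 0ℓ} (isU : IsUltrafilter 𝓤) (uniform : Uniform 𝓤)
    (indec : Indecomposable W 𝓤)
    {T : Set} {_<ᵀ_ : Rel T 0ℓ} (aronszajn : IsAronszajn _<_ _<ᵀ_) where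

    open IsRegularCardinal reg
    open IsCardinal isCardinal
    open IsStrictTotalOrder (IsWellOrder.isStrictTotalOrder isWellOrder)
      using () renaming (trans to <-trans)
    open IsUltrafilter isU
    open IsAronszajn aronszajn
    open HasHeightκ height
    open Tree isWellOrder isTree
    open Ultrafilter isU
    open _≼_
    open IndecomposableUltrafilter isCardinal aleph 2^W≺K indec
    open Regular reg

    private
      Node : K → Set
      Node α = [ t ∈ T ∣ Level _<_ _<ᵀ_ α t ]

      e : K → ℕ
      e = proj₁ finest-small

      e-finest : ∀ {M} → M ≺ K → (f : K → M) → f ≼ e
      e-finest = proj₂ finest-small

      top : ∀ γ → ∃[ t ] Level _<_ _<ᵀ_ γ t
      top = nonEmpty

      p : ∀ α → K → Node α
      p α γ with em {α < γ}
      ... | yes α<γ = let s , s∈α , _ = predecessor α<γ (proj₂ (top γ)) in s ,ʳ [ s∈α ]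
      -- Default for the `γ` not above `α`, which form a set outside `𝓤` by `tails`.
      ... | no _    = proj₁ (top α) ,ʳ [ proj₂ (top α) ]

      p<top : ∀ {α γ} → α < γ → value (p α γ) <ᵀ proj₁ (top γ)
      p<top {α} {γ} α<γ with em {α < γ}
      ... | yes α<γ′ = proj₂ (proj₂ (predecessor α<γ′ (proj₂ (top γ))))
      ... | no α≮γ   = contradiction α<γ α≮γ

      f : ∀ α → ℕ → Node α
      f α = factor (e-finest (smallLevels α) (p α))

      p≡f : ∀ α → (λ γ → p α γ ≡ f α (e γ)) ∈ 𝓤
      p≡f α = factors (e-finest (smallLevels α) (p α))

      Agree : K → K → ℕ → Set
      Agree α β i = value (f α i) <ᵀ value (f β i)

      -- For almost all `γ` the two nodes at index `e γ` are the projections of the same `top γ`, so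
      -- they are comparable.
      agree-large : ∀ {α β} → α < β → (λ γ → Agree α β (e γ)) ∈ 𝓤
      agree-large {α} {β} α<β = upward (meet (meet (p≡f α) (p≡f β)) (tails isU uniform β))
        λ ((pα , pβ) , β<γ) → subst₂ (λ s s′ → value s <ᵀ value s′) pα pβ
          (below-common α<β (member (p α _)) (member (p β _))
            (p<top (<-trans α<β β<γ)) (p<top β<γ))

      ℕ↣W : ℕ ↣ W
      ℕ↣W = proj₁ (IsAleph₁.uncountable aleph)

      -- `Agree α β` is the set called `A α β` at the outset. As a subset of ω it is one of fewer
      -- than κ many, so `e-finest` applies.
      traces : ∀ α → (λ β i → truth (Agree α β i)) ≼ e
      traces α = e-finest (→-≺ (ℕ↣W ↣-∘ ×-countable (↣-id ℕ) Bool-countable)) _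

      φ : K → ℕ × ℕ → Bool
      φ α = uncurry (factor (traces α))

      φ≼e : φ ≼ e
      φ≼e = e-finest (→-≺ (ℕ↣W ↣-∘
              ×-countable (×-countable (↣-id ℕ) (↣-id ℕ)) Bool-countable)) φ

      Ψ : ℕ → ℕ × ℕ → Bool
      Ψ = factor φ≼e

      Q : ℕ → ℕ → Pred ℕ 0ℓ
      Q k n i = Ψ k (n , i) ≡ true

      x : ℕ → ℕ
      x = proj₁ (pseudo-intersection e Q)

      Good : K → K → Set
      Good α β = ∀ i → truth (Agree α β i) ≡ Ψ (e α) (e β , i)

      Typical : Pred K 0ℓ
      Typical α = (λ β → α < β × Good α β) ∈ 𝓤

      typical-large : Typical ∈ 𝓤
      typical-large = upward (factors φ≼e) λ {α} φ≡Ψ →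
        upward (meet (factors (traces α)) (tails isU uniform α))
          λ (eq , α<β) → α<β , λ i → trans (cong-app eq i) (cong-app φ≡Ψ (_ , i))

      -- By `Good`, the set `Q (e α) (e β)` is `Agree α β`, which is in the image of `𝓤` under `e`
      -- by `agree-large`; so `x i` lies in it once `i` exceeds both indices.
      agree-x : ∀ {α β i} → α < β → Good α β → e α ℕ.< i → e β ℕ.< i → Agree α β (x i)
      agree-x {α} {β} {i} α<β good eα<i eβ<i = truth-elim (trans (good (x i))
        (proj₂ (pseudo-intersection e Q) eα<i eβ<i
          (upward (agree-large α<β) λ {γ} a →
            trans (sym (good (e γ))) (truth-intro a))))

      above : ∀ α → ∃[ β ] Typical β × α < β
      above α = inhabited (meet typical-large (tails isU uniform α))

      _* : K → K
      α * = proj₁ (above α)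

      -- The level `α` itself may not be typical, so its node is projected from the typical level
      -- `α *`.
      h : ∀ α i → ∃[ s ] Level _<_ _<ᵀ_ α s × s <ᵀ value (f (α *) (x i))
      h α i = predecessor (proj₂ (proj₂ (above α))) (member (f (α *) (x i)))

    path : K → ℕ → T
    path α i = proj₁ (h α i)

    isAscentPath : IsAscentPath _<_ _<ᵀ_ path
    isAscentPath = record
      { onLevel = λ α i → proj₁ (proj₂ (h α i))
      ; ascent  = ascend
      }
      where
      ascend : ∀ {α β} → α < β → ∃[ n ] ∀ i → n ≤ i → path α i <ᵀ path β i
      ascend {α} {β} α<β =
        -- The levels `α *` and `β *` may stand in any order, so they are compared through a common
        -- `γ` above both.
        let γ , (α*<γ , goodα) , (β*<γ , goodβ) =
              inhabited (meet (proj₁ (proj₂ (above α))) (proj₁ (proj₂ (above β))))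
        -- Beyond this bound `i` exceeds the three indices that the two uses of `agree-x` require.
        in suc (e (α *) + e (β *) + e γ) , λ i n≤i →
          let eα<i = ℕ.≤-trans (ℕ.s≤s (ℕ.≤-trans (ℕ.m≤m+n (e (α *)) (e (β *)))
                                                 (ℕ.m≤m+n _ (e γ)))) n≤i
              eβ<i = ℕ.≤-trans (ℕ.s≤s (ℕ.≤-trans (ℕ.m≤n+m (e (β *)) (e (α *)))
                                                 (ℕ.m≤m+n _ (e γ)))) n≤i
              eγ<i = ℕ.≤-trans (ℕ.s≤s (ℕ.m≤n+m (e γ) _)) n≤i
              _ , hα∈α , hα<f = h α i
              _ , hβ∈β , hβ<f = h β i
          in below-common α<β hα∈α hβ∈β
               (ᵀ-trans hα<f (agree-x α*<γ goodα eα<i eγ<i))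
               (ᵀ-trans hβ<f (agree-x β*<γ goodβ eβ<i eγ<i))
        where
        open IsStrictPartialOrder (IsTree.isStrictPartialOrder isTree)
          using () renaming (trans to ᵀ-trans)

theorem4p10 : (∀ {ℓ} → ExcludedMiddle ℓ) →
    (∀ {a b} → Extensionality a b) →
    (K : Set) (_<_ : Rel K 0ℓ) → IsRegularCardinal _<_ →
    (ω₁ : Set) → IsAleph₁ ω₁ → (𝟚^ ω₁) ≺ K →
    (∃[ 𝓤 ] IsUltrafilter {K} 𝓤 × Uniform 𝓤 × Indecomposable ω₁ 𝓤) →
    (T : Set) (_<ᵀ_ : Rel T 0ℓ) → IsAronszajn _<_ _<ᵀ_ →
    ∃[ f ] IsAscentPath _<_ _<ᵀ_ f
theorem4p10 em ext K _<_ reg ω₁ aleph 2^ω₁≺K (𝓤 , isU , uniform , indec) T _<ᵀ_ aronszajn =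
  path , isAscentPath
  where
  open Classical em ext
  open AscentPath reg aleph 2^ω₁≺K isU uniform indec aronszajn
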